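{- There is an absolute constant $C$ such that for every positive integer $n$ and every graph $G$ on $n$ vertices with maximum degree $2$, $\min\overline{R}(G)\leq Cn$.
   Context: An ordered graph is a pair $\mathcal{G}=(G,\prec)$ where $G$ is a (simple) graph and $\prec$ is a total ordering of its vertices; $\mathcal{G}$ is called an ordering of $G$. Two ordered graphs are isomorphic if there is a graph isomorphism between them preserving the vertex orderings. $\mathcal{K}_N$ denotes the (unique up to isomorphism) ordered complete graph on $N$ vertices. $\mathcal{G}=(G,\prec_1)$ is an ordered subgraph of $\mathcal{H}=(H,\prec_2)$ if $G$ is a subgraph of $H$ and $\prec_1$ is a suborder of $\prec_2$. The ordered Ramsey number $\overline{R}(\mathcal{G})$ is the minimum integer $N$ such that every $2$-coloring of the edges of $\mathcal{K}_N$ contains a monochromatic ordered subgraph isomorphic to $\mathcal{G}$. For a graph $G$, $\min\overline{R}(G):=\min\{\overline{R}(\mathcal{G}) : \mathcal{G}\text{ is an ordering of }G\}$. -}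

module Defs where

open import Data.Bool.Base using (Bool)
open import Data.Fin.Base as Fin using (Fin)
open import Data.Fin.Properties as Fin using ()
open import Data.List.Base using (length; filter; map; allFin)
open import Data.List.Extrema.Nat using (max)
open import Data.Nat.Base using (ℕ; _≤_)
open import Data.Product.Base using (_×_; ∃-syntax)
open import Level using (0ℓ)
open import Relation.Binary.Core using (Rel)
open import Relation.Binary.Definitions using (Decidable; Symmetric; Irreflexive)
open import Relation.Binary.Morphism.Structures using (IsOrderMonomorphism)
open import Relation.Binary.PropositionalEquality
  using (_≡_; _≢_; ≢-sym)
open import Relation.Binary.Structures using (IsStrictTotalOrder)
open import Relation.Nullary.Decidable using (¬?)
open import Relation.Unary using (Pred)

-- Finite simple graphs on the vertex set Fin n.  Adjacency is decidable, as
-- is automatic classically; degrees could not be counted otherwise.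
record Graph (n : ℕ) : Set₁ where
  infix 4 _~_ _~?_
  field
    _~_    : Rel (Fin n) 0ℓ
    _~?_   : Decidable _~_
    sym    : Symmetric _~_
    irrefl : Irreflexive _≡_ _~_

degree : ∀ {n} → Graph n → Fin n → ℕ
degree {n} G v = length (filter (v ~?_) (allFin n))
  where open Graph G

-- The leading 0 only matters for the graph without vertices.
maxDegree : ∀ {n} → Graph n → ℕ
maxDegree {n} G = max 0 (map (degree G) (allFin n))

record VertexOrder (n : ℕ) : Set₁ where
  infix 4 _≺_
  field
    _≺_                : Rel (Fin n) 0ℓ
    isStrictTotalOrder : IsStrictTotalOrder _≡_ _≺_

-- The orderings of G are the ordered graphs (G , ≺).
record OrderedGraph (n : ℕ) : Set₁ where
  constructor _,_
  field
    graph : Graph n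
    order : VertexOrder n
  open Graph graph public
  open VertexOrder order public

complete : ∀ N → Graph N
complete N = record
  { _~_    = _≢_
  ; _~?_   = λ u v → ¬? (u Fin.≟ v)
  ; sym    = ≢-sym
  ; irrefl = λ u≡v u≢v → u≢v u≡v
  }

𝒦 : ∀ N → OrderedGraph N
𝒦 N = complete N , record
  { _≺_                = Fin._<_
  ; isStrictTotalOrder = Fin.<-isStrictTotalOrder
  }

-- An ordered subgraph of ℋ together with an isomorphism from 𝒢 onto it: the
-- subgraph has as vertices and edges the images of those of 𝒢 under embed.
-- It need not be induced.
record Copy {m n} (𝒢 : OrderedGraph m) (ℋ : OrderedGraph n) : Set where
  private
    module 𝒢 = OrderedGraph 𝒢
    module ℋ = OrderedGraph ℋ
  field
    embed               : Fin m → Fin n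
    isOrderMonomorphism : IsOrderMonomorphism _≡_ _≡_ 𝒢._≺_ ℋ._≺_ embed
    preserves-~         : ∀ {u v} → u 𝒢.~ v → embed u ℋ.~ embed v

-- A 2-colouring of the edges {u , v} of the complete graph on Fin N, given on
-- ordered pairs of vertices.  The values on the diagonal are irrelevant, since
-- only edges are inspected below.
record Colouring (N : ℕ) : Set where
  field
    colour : Fin N → Fin N → Bool
    comm   : ∀ u v → colour u v ≡ colour v u

Monochromatic : ∀ {n N} {𝒢 : OrderedGraph n} → Colouring N → Copy 𝒢 (𝒦 N) → Set
Monochromatic {𝒢 = 𝒢} χ H =
  ∃[ c ] ∀ {u v} → u ~ v → colour (embed u) (embed v) ≡ c
  where
  open OrderedGraph 𝒢 using (_~_)
  open Colouring χ
  open Copy H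

infix 4 _⟶_
_⟶_ : ∀ {n} → ℕ → OrderedGraph n → Set
N ⟶ 𝒢 = (χ : Colouring N) → ∃[ H ] Monochromatic {𝒢 = 𝒢} χ H

IsMinimumOf : ∀ {ℓ} → Pred ℕ ℓ → Pred ℕ ℓ
IsMinimumOf P m = P m × (∀ k → P k → m ≤ k)

-- OrderedRamseyNumber 𝒢 N  says  R̄(𝒢) = N.
OrderedRamseyNumber : ∀ {n} → OrderedGraph n → ℕ → Set
OrderedRamseyNumber 𝒢 = IsMinimumOf (_⟶ 𝒢)

-- MinOrderedRamseyNumber G r  says  min R̄(G) = r.
MinOrderedRamseyNumber : ∀ {n} → Graph n → ℕ → Set₁
MinOrderedRamseyNumber G =
  IsMinimumOf (λ r → ∃[ ≺ ] OrderedRamseyNumber (G , ≺) r)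

{-# OPTIONS --safe #-}

-- A graph of maximum degree at most 2 has bandwidth at most 2, so it embeds into
-- the square of a path 0, 1, …, n - 1, and it suffices to find the latter,
-- ordered lexicographically by (t mod 3 , t), in one colour.  Split the 6M
-- vertices of 𝒦 (6M) into 6 intervals of length M.  As R(3,3) = 6, each choice
-- of one vertex per interval contains a monochromatic triangle.  Increasing the
-- three vertices of a triangle in turn, always keeping a triangle of the same
-- colour on the same intervals, produces the square of a path.  If no triangle
-- admits n such steps, then a choice of 6 vertices is determined by the colour
-- and the intervals of its triangle (at most 2 · 6³ = 432 values), the step at
-- which the triangle gets stuck, and the 5 vertices other than the one that
-- cannot be increased; hence M⁶ ≤ 432 n M⁵.
module Submission where

open import Defs
open import Data.Bool.Base using (Bool; true; false; not; _∧_)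
import Data.Bool.Properties as Bool
open import Data.Fin.Base as Fin
  using (Fin; zero; suc; toℕ; combine; remQuot; finToFun; funToFin; punchOut)
open import Data.Fin.Patterns
import Data.Fin.Properties as Fin
open import Data.List.Base as List using (List; []; _∷_; length; drop; filter; allFin)
open import Data.List.Extrema.Nat using (xs≤max)
import Data.List.Membership.DecPropositional as DecMembership
open import Data.List.Membership.Propositional using (_∈_; _∉_)
open import Data.List.Membership.Propositional.Properties using (∈-filter⁺; ∈-allFin; ∈-lookup)
open import Data.List.Membership.Setoid.Properties using (index-injective)
open import Data.List.Relation.Unary.All as All using (All; []; _∷_)
open import Data.List.Relation.Unary.All.Properties using (¬Any⇒All¬; map⁻)
open import Data.List.Relation.Unary.AllPairs using ([]; _∷_)
open import Data.List.Relation.Unary.Any using (here; there; index)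
open import Data.List.Relation.Unary.Unique.Propositional using (Unique)
open import Data.Nat.Base
  using (ℕ; zero; suc; _+_; _*_; _^_; _≤_; _<_; z≤n; s≤s; z<s; s<s; >-nonZero)
import Data.Nat.Properties as ℕ
open import Data.Product.Base using (_×_; _,_; proj₁; proj₂; ∃; ∃₂; ∃-syntax)
open import Data.Sum.Base using (_⊎_; inj₁; inj₂; [_,_]′)
open import Data.Vec.Base using (Vec; lookup; removeAt; _[_]≔_; tabulate)
import Data.Vec.Functional as F
open import Data.Vec.Properties
  using (lookup∘update; lookup∘update′; []≔-lookup; lookup∘tabulate; tabulate∘lookup;
         tabulate-cong; removeAt-punchOut)
open import Function.Base using (_∘_; _$_; id)
open import Function.Bundles using (Inverse)
open import Function.Definitions using (Injective)
open import Level using (0ℓ)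
open import Relation.Binary.Core using (Rel)
open import Relation.Binary.Definitions using (tri<; tri≈; tri>; _Respects_)
  renaming (Decidable to Decidable₂)
import Relation.Binary.Morphism.OrderMonomorphism as OrderMonomorphism
open import Relation.Binary.Morphism.Structures using (IsOrderMonomorphism)
open import Relation.Binary.PropositionalEquality
  using (_≡_; _≢_; _≗_; refl; sym; trans; cong; cong₂; subst; subst₂; ≢-sym; setoid;
         module ≡-Reasoning)
open import Relation.Binary.Structures using (IsStrictTotalOrder)
open import Relation.Nullary using (¬_; Dec; yes; no; contradiction)
open import Relation.Nullary.Decidable
  using (_×-dec_; _→-dec_; _⊎-dec_; map′; ¬?; decidable-stable)
open import Relation.Unary using (Pred; Decidable)

-- Codes of functions and tuples over finite sets

funToFin-cong : ∀ {m n} {f g : Fin m → Fin n} → f ≗ g → funToFin f ≡ funToFin g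
funToFin-cong {zero}  f≗g = refl
funToFin-cong {suc m} f≗g = cong₂ combine (f≗g zero) (funToFin-cong (f≗g ∘ suc))

funToFin-injective : ∀ {m n} {f g : Fin m → Fin n} → funToFin f ≡ funToFin g → f ≗ g
funToFin-injective {f = f} {g} eq i = begin
  f i                        ≡⟨ Fin.finToFun-funToFin f i ⟨
  finToFun (funToFin f) i    ≡⟨ cong (λ k → finToFun k i) eq ⟩
  finToFun (funToFin g) i    ≡⟨ Fin.finToFun-funToFin g i ⟩
  g i                        ∎
  where open ≡-Reasoning

lookup-injective : ∀ {a} {A : Set a} {n} {xs ys : Vec A n} → lookup xs ≗ lookup ys → xs ≡ ys
lookup-injective {xs = xs} {ys} eq = begin
  xs                   ≡⟨ tabulate∘lookup xs ⟨
  tabulate (lookup xs) ≡⟨ tabulate-cong eq ⟩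
  tabulate (lookup ys) ≡⟨ tabulate∘lookup ys ⟩
  ys                   ∎
  where open ≡-Reasoning

removeAt-update : ∀ {a} {A : Set a} {n} (xs ys : Vec A (suc n)) i →
  removeAt xs i ≡ removeAt ys i → xs [ i ]≔ lookup ys i ≡ ys
removeAt-update xs ys i eq = lookup-injective λ j → helper j (i Fin.≟ j)
  where
  open ≡-Reasoning
  helper : ∀ j → Dec (i ≡ j) → lookup (xs [ i ]≔ lookup ys i) j ≡ lookup ys j
  helper j (yes refl) = lookup∘update i xs _
  helper j (no i≢j)   = begin
    lookup (xs [ i ]≔ lookup ys i) j        ≡⟨ lookup∘update′ (i≢j ∘ sym) xs _ ⟩
    lookup xs j                             ≡⟨ removeAt-punchOut xs i≢j ⟨
    lookup (removeAt xs i) (punchOut i≢j)   ≡⟨ cong (λ zs → lookup zs (punchOut i≢j)) eq ⟩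
    lookup (removeAt ys i) (punchOut i≢j)   ≡⟨ removeAt-punchOut ys i≢j ⟩
    lookup ys j                             ∎

combine-monoʳ-< : ∀ {m n} {i j : Fin m} {k l : Fin n} → i ≡ j → k Fin.< l → combine i k Fin.< combine j l
combine-monoʳ-< {n = n} {i} {k = k} {l} refl k<l
  rewrite Fin.toℕ-combine i k | Fin.toℕ-combine i l = ℕ.+-monoʳ-< (n * toℕ i) k<l

-- Staircases in a set of tuples

-- x starts a staircase of t steps inside P, of which step i increases the
-- coordinate p i.  By the first component, a member of P that does not start
-- one has a first value of t at which it fails (see Stuck).
Climbs : ∀ {M d} → Pred (Vec (Fin M) d) 0ℓ → ℕ → (ℕ → Fin d) → Pred (Vec (Fin M) d) 0ℓ
Climbs P zero    p x = P x
Climbs P (suc t) p x = Climbs P t (p ∘ suc) x ×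
  ∃[ y ] (lookup x (p 0) Fin.< y × Climbs P t (p ∘ suc) (x [ p 0 ]≔ y))

module _ {M d} {P : Pred (Vec (Fin M) d) 0ℓ} where

  climbs? : Decidable P → ∀ t p → Decidable (Climbs P t p)
  climbs? P? zero    p x = P? x
  climbs? P? (suc t) p x = climbs? P? t (p ∘ suc) x ×-dec
    Fin.any? λ y → (lookup x (p 0) Fin.<? y) ×-dec climbs? P? t (p ∘ suc) (x [ p 0 ]≔ y)

  -- After its `t` steps the staircase stays at its last tuple, so only `stair-step` needs a bound
  -- on the index.
  stair : ∀ t p {x} → Climbs P t p x → ℕ → Vec (Fin M) d
  stair zero    p {x} _             _       = x
  stair (suc t) p {x} _             zero    = x
  stair (suc t) p     (_ , _ , _ , h) (suc i) = stair t (p ∘ suc) h i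

  climbs⇒P : ∀ t p {x} → Climbs P t p x → P x
  climbs⇒P zero    p h       = h
  climbs⇒P (suc t) p (h , _) = climbs⇒P t (p ∘ suc) h

  stair-P : ∀ t p {x} (h : Climbs P t p x) i → P (stair t p h i)
  stair-P zero    p h             _       = h
  stair-P (suc t) p h             zero    = climbs⇒P (suc t) p h
  stair-P (suc t) p (_ , _ , _ , h) (suc i) = stair-P t (p ∘ suc) h i

  stair-zero : ∀ t p {x} (h : Climbs P t p x) → stair t p h 0 ≡ x
  stair-zero zero    p h = refl
  stair-zero (suc t) p h = refl

  stair-step : ∀ t p {x} (h : Climbs P t p x) i → i < t →
    lookup (stair t p h i) (p i) Fin.< lookup (stair t p h (suc i)) (p i)
  stair-step (suc t) p {x} (_ , y , x<y , h) zero _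
    rewrite stair-zero t (p ∘ suc) h | lookup∘update (p 0) x y = x<y
  stair-step (suc t) p (_ , _ , _ , h) (suc i) (s<s i<t) = stair-step t (p ∘ suc) h i i<t

  stair-keep : ∀ t p {x} (h : Climbs P t p x) i {a} → a ≢ p i →
    lookup (stair t p h (suc i)) a ≡ lookup (stair t p h i) a
  stair-keep zero    p h i a≢ = refl
  stair-keep (suc t) p {x} (_ , y , _ , h) zero {a} a≢
    rewrite stair-zero t (p ∘ suc) h = lookup∘update′ a≢ x y
  stair-keep (suc t) p (_ , _ , _ , h) (suc i) a≢ = stair-keep t (p ∘ suc) h i a≢

  -- Of the conditions Climbs P s (λ i → p (t ∸ s + i)) x, for s = 0, …, t, the
  -- one for s = t ∸ k is the first to fail.
  data Stuck : (t : ℕ) (p : ℕ → Fin d) (x : Vec (Fin M) d) → Fin t → Set where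
    here  : ∀ {t p x} → Climbs P t (p ∘ suc) x →
            (∀ y → lookup x (p 0) Fin.< y → ¬ Climbs P t (p ∘ suc) (x [ p 0 ]≔ y)) →
            Stuck (suc t) p x zero
    there : ∀ {t p x k} → Stuck t (p ∘ suc) x k → Stuck (suc t) p x (suc k)

  -- `Climbs P (suc t) p x` contains `Climbs P t (p ∘ suc) x`, so the conditions get stronger with
  -- the number of steps. Zero steps succeed by `P x`, hence the descent from `t` reaches the first
  -- failure.
  stuck : Decidable P → ∀ t p {x} → P x → ¬ Climbs P t p x → ∃ (Stuck t p x)
  stuck P? zero    p px ¬h = contradiction px ¬h
  stuck P? (suc t) p {x} px ¬h with climbs? P? t (p ∘ suc) x
  ... | yes h  = zero , here h λ y x<y hy → ¬h (h , y , x<y , hy)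
  ... | no ¬h′ = let k , s = stuck P? t (p ∘ suc) px ¬h′ in suc k , there s

-- Of two tuples that differ only in the coordinate p k, the smaller one can
-- step to the larger one.
stuck-unique : ∀ {M d} {P : Pred (Vec (Fin M) (suc d)) 0ℓ} {t p x x′ k} →
  Stuck {P = P} t p x k → Stuck {P = P} t p x′ k →
  removeAt x (p (toℕ k)) ≡ removeAt x′ (p (toℕ k)) → x ≡ x′
stuck-unique {P = P} {p = p} {x} {x′} (here {t} h ¬y) (here h′ ¬y′) eq
  with Fin.<-cmp (lookup x (p 0)) (lookup x′ (p 0))
... | tri< x<x′ _ _ = contradiction
  (subst (Climbs P t _) (sym (removeAt-update x x′ (p 0) eq)) h′) (¬y _ x<x′)
... | tri> _ _ x>x′ = contradiction
  (subst (Climbs P t _) (sym (removeAt-update x′ x (p 0) (sym eq))) h) (¬y′ _ x>x′)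
... | tri≈ _ x≡x′ _ = begin
  x                          ≡⟨ []≔-lookup x (p 0) ⟨
  x [ p 0 ]≔ lookup x (p 0)  ≡⟨ cong (x [ p 0 ]≔_) x≡x′ ⟩
  x [ p 0 ]≔ lookup x′ (p 0) ≡⟨ removeAt-update x x′ (p 0) eq ⟩
  x′                         ∎
  where open ≡-Reasoning
stuck-unique (there s) (there s′) eq = stuck-unique s s′ eq

-- Otherwise every tuple is determined by its class, the step at which it is
-- stuck, and all coordinates but the one of that step.
longStaircase : ∀ {K M d} n (P : Fin K → Pred (Vec (Fin M) (suc d)) 0ℓ) → (∀ κ → Decidable (P κ)) →
  (p : Fin K → ℕ → Fin (suc d)) → (∀ x → ∃[ κ ] P κ x) → K * n < M →
  ∃₂ λ κ x → Climbs (P κ) n (p κ) x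
longStaircase {K} {M} {d} n P P? p cover Kn<M
  with Fin.any? {n = M ^ suc d} (λ i → let x = tabulate (finToFun i); κ = proj₁ (cover x) in
                   climbs? (P? κ) n (p κ) x)
... | yes (i , h) = _ , _ , h
... | no ¬climbs = contradiction M≤Kn (ℕ.<⇒≱ Kn<M)
  where
  tuple : Fin (M ^ suc d) → Vec (Fin M) (suc d)
  tuple i = tabulate (finToFun i)

  tuple-injective : ∀ {i j} → tuple i ≡ tuple j → i ≡ j
  tuple-injective {i} {j} eq = begin
    i                                   ≡⟨ Fin.funToFin-finToFin {suc d} {M} i ⟨
    funToFin (finToFun {M} {suc d} i)   ≡⟨ funToFin-cong (λ a → begin
      finToFun i a          ≡⟨ lookup∘tabulate (finToFun i) a ⟨
      lookup (tuple i) a    ≡⟨ cong (λ x → lookup x a) eq ⟩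
      lookup (tuple j) a    ≡⟨ lookup∘tabulate (finToFun j) a ⟩
      finToFun j a          ∎) ⟩
    funToFin (finToFun {M} {suc d} j)   ≡⟨ Fin.funToFin-finToFin {suc d} {M} j ⟩
    j                                   ∎
    where open ≡-Reasoning

  class : Fin (M ^ suc d) → Fin K
  class i = proj₁ (cover (tuple i))

  stuckAt : ∀ i → ∃ (Stuck n (p (class i)) (tuple i))
  stuckAt i = stuck (P? (class i)) n _ (proj₂ (cover (tuple i))) λ h → ¬climbs (i , h)

  -- The omitted coordinate is the one named by `κ` and `k`, so equal codes omit the same coordinate
  -- and `stuck-unique` applies.
  code : Fin K → Fin n → Vec (Fin M) (suc d) → Fin (K * (n * M ^ d))
  code κ k x = combine κ (combine k (funToFin (lookup (removeAt x (p κ (toℕ k))))))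

  code-injective : ∀ {κ κ′ k k′ x x′} →
    Stuck {P = P κ} n (p κ) x k → Stuck {P = P κ′} n (p κ′) x′ k′ →
    code κ k x ≡ code κ′ k′ x′ → x ≡ x′
  code-injective {κ} {κ′} {k} {k′} s s′ eq
    with refl , eq₁ ← Fin.combine-injective κ _ κ′ _ eq
    with refl , eq₂ ← Fin.combine-injective k _ k′ _ eq₁ =
    stuck-unique s s′ (lookup-injective (funToFin-injective eq₂))

  M≤Kn : M ≤ K * n
  -- The `M ^ suc d` tuples inject into the codes; cancelling `M ^ d` needs `M` nonzero, which
  -- `Kn<M` gives.
  M≤Kn = ℕ.*-cancelʳ-≤ M (K * n) (M ^ d) {{ℕ.m^n≢0 M d {{>-nonZero (ℕ.m<n⇒0<n Kn<M)}}}} $ begin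
    M ^ suc d         ≤⟨ Fin.injective⇒≤ {f = λ i → code (class i) (proj₁ (stuckAt i)) (tuple i)}
                           (λ {i} {j} eq → tuple-injective
                             (code-injective (proj₂ (stuckAt i)) (proj₂ (stuckAt j)) eq)) ⟩
    K * (n * M ^ d)   ≡⟨ ℕ.*-assoc K n (M ^ d) ⟨
    K * n * M ^ d     ∎
    where open ℕ.≤-Reasoning

-- Monochromatic triangles on six vertices, with ordered corners

StrictMono : ∀ {m n} → (Fin m → Fin n) → Set
StrictMono f = ∀ i j → i Fin.< j → f i Fin.< f j

suc-mono : ∀ {m n} {g : Fin m → Fin n} → StrictMono g → StrictMono (suc ∘ g)
suc-mono g-mono i j i<j = s<s (g-mono i j i<j)

cons-mono : ∀ {m n} {g : Fin m → Fin n} → StrictMono g → StrictMono (zero F.∷ (suc ∘ g))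
cons-mono g-mono zero    (suc j) _         = z<s
cons-mono g-mono (suc i) (suc j) (s<s i<j) = s<s (g-mono i j i<j)

-- Pigeonhole by induction on `m`: the value at `zero` decides whether `r` or `s` drops. Increasing
-- maps keep the corners of the later triangles in order.
monochromaticSubset : ∀ r s {m} → r + s ≤ suc m → (f : Fin m → Bool) →
  (∃[ g ] StrictMono {r} g × ∀ i → f (g i) ≡ true) ⊎
  (∃[ g ] StrictMono {s} g × ∀ i → f (g i) ≡ false)
monochromaticSubset zero s _ f = inj₁ ((λ ()) , (λ ()) , (λ ()))
monochromaticSubset (suc r) zero _ f = inj₂ ((λ ()) , (λ ()) , (λ ()))
monochromaticSubset (suc r) (suc s) {zero} (s≤s le) f = contradiction (ℕ.≤-trans (ℕ.m≤n+m (suc s) r) le) λ ()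
monochromaticSubset (suc r) (suc s) {suc m} (s≤s le) f with f zero in eq
... | true with monochromaticSubset r (suc s) le (f ∘ suc)
...   | inj₁ (g , mono , fg) = inj₁ (zero F.∷ (suc ∘ g) , cons-mono mono , λ { zero → eq ; (suc i) → fg i })
...   | inj₂ (g , mono , fg) = inj₂ (suc ∘ g , suc-mono mono , fg)
monochromaticSubset (suc r) (suc s) {suc m} (s≤s le) f | false
  with monochromaticSubset (suc r) s (subst (_≤ suc m) (ℕ.+-suc r s) le) (f ∘ suc)
...   | inj₁ (g , mono , fg) = inj₁ (suc ∘ g , suc-mono mono , fg)
...   | inj₂ (g , mono , fg) = inj₂ (zero F.∷ (suc ∘ g) , cons-mono mono , λ { zero → eq ; (suc i) → fg i })

MonoTriangle : ∀ {n} → (Fin n → Fin n → Bool) → Bool → (Fin 3 → Fin n) → Set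
MonoTriangle χ c f = ∀ i j → i Fin.< j → f i Fin.< f j × χ (f i) (f j) ≡ c

triangle : ∀ {n} (χ : Fin n → Fin n → Bool) {c} {u v w : Fin n} → u Fin.< v → v Fin.< w →
  χ u v ≡ c → χ u w ≡ c → χ v w ≡ c → MonoTriangle χ c (u F.∷ v F.∷ w F.∷ F.[])
triangle χ u<v v<w uv uw vw 0F 1F _ = u<v , uv
triangle χ u<v v<w uv uw vw 0F 2F _ = Fin.<-trans u<v v<w , uw
triangle χ u<v v<w uv uw vw 1F 2F _ = v<w , vw
triangle χ u<v v<w uv uw vw 1F 1F (s<s ())
triangle χ u<v v<w uv uw vw 2F 1F (s<s ())
triangle χ u<v v<w uv uw vw 2F 2F (s<s (s<s ()))

-- Vertex `zero` has five edges, three of which share a colour as 3 + 3 ≤ 6. An edge of that colour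
-- between their other ends closes a triangle; if there is none, these ends form a triangle of the
-- other colour.
ramsey₃₃ : (χ : Fin 6 → Fin 6 → Bool) → ∃₂ (MonoTriangle χ)
ramsey₃₃ χ = fromStar (monochromaticSubset 3 3 ℕ.≤-refl (χ zero ∘ suc))
  where
  closeStar : ∀ c (g : Fin 3 → Fin 5) → StrictMono g → (∀ i → χ zero (suc (g i)) ≡ c) → ∃₂ (MonoTriangle χ)
  closeStar c g mono star
    with χ (suc (g 0F)) (suc (g 1F)) Bool.≟ c
       | χ (suc (g 0F)) (suc (g 2F)) Bool.≟ c
       | χ (suc (g 1F)) (suc (g 2F)) Bool.≟ c
  ... | yes eq | _ | _ = c , _ , triangle χ z<s (s<s (mono 0F 1F z<s)) (star 0F) (star 1F) eq
  ... | no _ | yes eq | _ = c , _ , triangle χ z<s (s<s (mono 0F 2F z<s)) (star 0F) (star 2F) eq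
  ... | no _ | no _ | yes eq = c , _ , triangle χ z<s (s<s (mono 1F 2F (s<s z<s))) (star 1F) (star 2F) eq
  ... | no ≢₁ | no ≢₂ | no ≢₃ = not c , _ , triangle χ (s<s (mono 0F 1F z<s)) (s<s (mono 1F 2F (s<s z<s)))
    (Bool.¬-not ≢₁) (Bool.¬-not ≢₂) (Bool.¬-not ≢₃)

  fromStar : _ → ∃₂ (MonoTriangle χ)
  fromStar (inj₁ (g , mono , star)) = closeStar true g mono star
  fromStar (inj₂ (g , mono , star)) = closeStar false g mono star

-- A monochromatic square of a path

-- Recursion by 3 makes `mod3 (3 + t)` reduce to `mod3 t`, so steps `t` and `3 + t` have
-- definitionally the same direction.
mod3 : ℕ → Fin 3
mod3 0 = 0F
mod3 1 = 1F
mod3 2 = 2F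
mod3 (suc (suc (suc t))) = mod3 t

mod3-suc : ∀ t → mod3 (suc t) ≢ mod3 t
mod3-suc (suc (suc (suc t))) = mod3-suc t
mod3-suc 0 ()
mod3-suc 1 ()
mod3-suc 2 ()

mod3-suc² : ∀ t → mod3 (suc (suc t)) ≢ mod3 t
mod3-suc² (suc (suc (suc t))) = mod3-suc² t
mod3-suc² 0 ()
mod3-suc² 1 ()
mod3-suc² 2 ()

-- The square of the path 0, 1, …, n - 1, with its vertices ordered
-- lexicographically by (t mod 3 , t), as a monochromatic subgraph.
record MonoPathSquare {N} (χ : Fin N → Fin N → Bool) (n : ℕ) : Set where
  field
    c      : Bool
    vertex : ℕ → Fin N
    mono₁  : ∀ {t t′} → mod3 t Fin.< mod3 t′ → vertex t Fin.< vertex t′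
    mono₂  : ∀ {t t′} → t < t′ → t′ < n → mod3 t ≡ mod3 t′ → vertex t Fin.< vertex t′
    edge   : ∀ {t t′} → t < t′ → t′ ≤ 2 + t → χ (vertex t) (vertex t′) ≡ c

-- The gap is `suc d`. Equal residues exclude gaps 1 and 2, gap 3 is `step`, and larger gaps are
-- reduced by 3.
growBy3 : ∀ (n : ℕ) (f : ℕ → ℕ) → (∀ t → t < n → f t < f (3 + t)) →
  ∀ d t → suc d + t < n → mod3 (suc d + t) ≡ mod3 t → f t < f (suc d + t)
growBy3 n f step 0 t _ eq = contradiction eq (mod3-suc t)
growBy3 n f step 1 t _ eq = contradiction eq (mod3-suc² t)
growBy3 n f step 2 t lt _ = step t (ℕ.<-trans (ℕ.m<n+m t z<s) lt)
growBy3 n f step (suc (suc (suc d))) t lt eq =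
  ℕ.<-trans (growBy3 n f step d t lt′ eq) (step (suc d + t) lt′)
  where
  lt′ : suc d + t < n
  lt′ = ℕ.<-trans (ℕ.m<n+m (suc d + t) {3} z<s) lt

-- A class is one of the 2 · 6³ = 432 pairs of a colour and a map from three corners to six
-- intervals. Step `t` raises corner `mod3 t`, and path vertex `t` is that corner just before step
-- `t`.
monoPathSquare : ∀ {n M} (χ : Colouring (6 * M)) → 432 * n < M → MonoPathSquare (Colouring.colour χ) n
monoPathSquare {n} {M} χ 432n<M = square (longStaircase n Triangle triangle? dir cover 432n<M)
  where
  open Colouring χ

  vtx : Vec (Fin M) 6 → Fin 6 → Fin (6 * M)
  vtx x a = combine a (lookup x a)

  hue : Fin (2 * 6 ^ 3) → Bool
  hue κ = Inverse.to Fin.2↔Bool (proj₁ (remQuot {2} (6 ^ 3) κ))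

  corner : Fin (2 * 6 ^ 3) → Fin 3 → Fin 6
  corner κ = finToFun (proj₂ (remQuot {2} (6 ^ 3) κ))

  Triangle : Fin (2 * 6 ^ 3) → Pred (Vec (Fin M) 6) 0ℓ
  Triangle κ x = MonoTriangle (λ a b → colour (vtx x a) (vtx x b)) (hue κ) (corner κ)

  triangle? : ∀ κ → Decidable (Triangle κ)
  triangle? κ x = Fin.all? λ i → Fin.all? λ j →
    (i Fin.<? j) →-dec ((corner κ i Fin.<? corner κ j) ×-dec (_ Bool.≟ hue κ))

  cover : ∀ x → ∃[ κ ] Triangle κ x
  cover x with c , f , tri ← ramsey₃₃ (λ a b → colour (vtx x a) (vtx x b)) = κ , tri′
    where
    κ : Fin (2 * 6 ^ 3)
    κ = combine {2} {6 ^ 3} (Inverse.from Fin.2↔Bool c) (funToFin f)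

    hue≡ : hue κ ≡ c
    hue≡ = trans (cong (Inverse.to Fin.2↔Bool ∘ proj₁) (Fin.remQuot-combine {2} {6 ^ 3} _ (funToFin f)))
                 (Inverse.strictlyInverseˡ Fin.2↔Bool c)

    corner≗ : corner κ ≗ f
    corner≗ i = trans (cong (λ q → finToFun (proj₂ q) i)
                        (Fin.remQuot-combine {2} {6 ^ 3} (Inverse.from Fin.2↔Bool c) (funToFin f)))
                      (Fin.finToFun-funToFin f i)

    tri′ : Triangle κ x
    tri′ i j i<j rewrite hue≡ | corner≗ i | corner≗ j = tri i j i<j

  dir : Fin (2 * 6 ^ 3) → ℕ → Fin 6
  dir κ t = corner κ (mod3 t)

  square : (∃₂ λ κ x → Climbs (Triangle κ) n (dir κ) x) → MonoPathSquare colour n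
  square (κ , x , climbs) = record
    { c = hue κ ; vertex = vertex
    -- Different residues give different intervals, so the positions inside the intervals do not
    -- matter.
    ; mono₁ = λ lt → Fin.combine-monoˡ-< _ _ (corner-mono lt)
    ; mono₂ = mono₂ ; edge = edge }
    where
    X : ℕ → Vec (Fin M) 6
    X = stair n (dir κ) climbs

    tri : ∀ t → Triangle κ (X t)
    tri = stair-P n (dir κ) climbs

    vertex : ℕ → Fin (6 * M)
    vertex t = vtx (X t) (dir κ t)

    corner-mono : ∀ {i j} → i Fin.< j → corner κ i Fin.< corner κ j
    corner-mono i<j = proj₁ (tri 0 _ _ i<j)

    corner-injective : ∀ {i j} → corner κ i ≡ corner κ j → i ≡ j
    corner-injective {i} {j} eq with Fin.<-cmp i j
    ... | tri< i<j _ _ = contradiction eq (Fin.<⇒≢ (corner-mono i<j))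
    ... | tri≈ _ i≡j _ = i≡j
    ... | tri> _ _ i>j = contradiction (sym eq) (Fin.<⇒≢ (corner-mono i>j))

    colours : ∀ t {i j} → i ≢ j → colour (vtx (X t) (corner κ i)) (vtx (X t) (corner κ j)) ≡ hue κ
    colours t {i} {j} i≢j with Fin.<-cmp i j
    ... | tri< i<j _ _ = proj₂ (tri t i j i<j)
    ... | tri≈ _ i≡j _ = contradiction i≡j i≢j
    ... | tri> _ _ i>j = trans (comm _ _) (proj₂ (tri t j i i>j))

    keep : ∀ t {i} → i ≢ mod3 t → lookup (X (suc t)) (corner κ i) ≡ lookup (X t) (corner κ i)
    keep t i≢ = stair-keep n (dir κ) climbs t (i≢ ∘ corner-injective)

    -- A corner is untouched until its own turn, so vertices `t`, `1 + t` and `2 + t` are the three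
    -- corners of the single triangle `X t`.
    keep₁ : ∀ t → lookup (X (1 + t)) (dir κ (1 + t)) ≡ lookup (X t) (dir κ (1 + t))
    keep₁ t = keep t (mod3-suc t)

    keep₂ : ∀ t → lookup (X (2 + t)) (dir κ (2 + t)) ≡ lookup (X t) (dir κ (2 + t))
    keep₂ t = trans (keep₁ (1 + t)) (keep t (mod3-suc² t))

    level : ℕ → ℕ
    level t = toℕ (lookup (X t) (dir κ t))

    -- Step `t` raises the corner, and steps `1 + t` and `2 + t` do not touch it, so the gain
    -- survives until vertex `3 + t`.
    level-step : ∀ t → t < n → level t < level (3 + t)
    level-step t t<n = subst (level t <_)
      (cong toℕ (sym (trans (keep (2 + t) (mod3-suc (2 + t))) (keep (1 + t) (mod3-suc² (1 + t))))))
      (stair-step n (dir κ) climbs t t<n)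

    mono₂ : ∀ {t t′} → t < t′ → t′ < n → mod3 t ≡ mod3 t′ → vertex t Fin.< vertex t′
    mono₂ {t} t<t′ t′<n eq with k , refl ← ℕ.m≤n⇒∃[o]m+o≡n t<t′
      with t′≡ ← ℕ.+-comm t k =
      combine-monoʳ-< (cong (corner κ) eq) (subst (λ s → level t < level (suc s)) (sym t′≡)
        (growBy3 n level level-step k t (subst (λ s → suc s < n) t′≡ t′<n)
                                         (trans (cong (mod3 ∘ suc) (sym t′≡)) (sym eq))))

    edge : ∀ {t t′} → t < t′ → t′ ≤ 2 + t → colour (vertex t) (vertex t′) ≡ hue κ
    edge {t} t<t′ t′≤ with ℕ.m≤n⇒m<n∨m≡n t′≤
    ... | inj₂ refl rewrite keep₂ t = colours t (≢-sym (mod3-suc² t))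
    ... | inj₁ (s<s t′≤1+t) with refl ← ℕ.≤-antisym t′≤1+t t<t′ rewrite keep₁ t = colours t (≢-sym (mod3-suc t))

-- Bandwidth at most 2 from maximum degree at most 2

coincide : ∀ {a} {A : Set a} {x y z : A} {xs} → length xs ≤ 2 → x ∈ xs → y ∈ xs → z ∈ xs →
  x ≡ y ⊎ x ≡ z ⊎ y ≡ z
coincide _ (here refl) (here refl) _ = inj₁ refl
coincide _ (here refl) (there _) (here refl) = inj₂ (inj₁ refl)
coincide _ (there _) (here refl) (here refl) = inj₂ (inj₂ refl)
coincide _ (there (here refl)) (there (here refl)) _ = inj₁ refl
coincide _ (there (here refl)) (here _) (there (here refl)) = inj₂ (inj₁ refl)
coincide _ (here _) (there (here refl)) (there (here refl)) = inj₂ (inj₂ refl)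
coincide (s≤s (s≤s ())) (there (there {xs = _ ∷ _} _)) _ _
coincide (s≤s (s≤s ())) _ (there (there {xs = _ ∷ _} _)) _
coincide (s≤s (s≤s ())) _ _ (there (there {xs = _ ∷ _} _))

unique⇒lookup-injective : ∀ {a} {A : Set a} {xs : List A} → Unique xs →
  ∀ {i j} → List.lookup xs i ≡ List.lookup xs j → i ≡ j
unique⇒lookup-injective (_ ∷ _) {zero} {zero} _ = refl
unique⇒lookup-injective (x≢ ∷ _) {zero} {suc j} eq = contradiction eq (All.lookup x≢ (∈-lookup j))
unique⇒lookup-injective (x≢ ∷ _) {suc i} {zero} eq = contradiction (sym eq) (All.lookup x≢ (∈-lookup i))
unique⇒lookup-injective (_ ∷ u) {suc i} {suc j} eq = cong suc (unique⇒lookup-injective u eq)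

index<2 : ∀ {a p} {A : Set a} {P : Pred A p} {x} {xs : List A} → All P (drop 2 xs) → (x∈xs : x ∈ xs) → ¬ P x →
  toℕ (index x∈xs) < 2
index<2 _   (here _)            ¬px = z<s
index<2 _   (there (here _))    ¬px = s<s z<s
index<2 all (there (there x∈))  ¬px = contradiction (All.lookup all x∈) ¬px

module Bandwidth {n} (G : Graph n) (Δ≤2 : maxDegree G ≤ 2) where
  open Graph G
    using (_~_; _~?_) renaming (sym to ~-sym)
  open DecMembership (Fin._≟_ {n}) using (_∈?_)

  -- The form in which the degree bound enters: pigeonhole on a neighbour list with at most two
  -- entries.
  neighbours-coincide : ∀ {u v w x} → u ~ v → u ~ w → u ~ x → v ≡ w ⊎ v ≡ x ⊎ w ≡ x
  neighbours-coincide {u} u~v u~w u~x = coincide deg≤2 (neighbour u~v) (neighbour u~w) (neighbour u~x)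
    where
    deg≤2 : degree G u ≤ 2
    deg≤2 = ℕ.≤-trans (All.lookup (map⁻ (xs≤max 0 (List.map (degree G) (allFin n)))) (∈-allFin u)) Δ≤2
    neighbour : ∀ {v} → u ~ v → v ∈ filter (u ~?_) (allFin n)
    neighbour = ∈-filter⁺ (u ~?_) (∈-allFin _)

  Closed : List (Fin n) → Pred (Fin n) 0ℓ
  Closed L u = ∀ {v} → u ~ v → v ∈ L

  OneFree : List (Fin n) → Pred (Fin n) 0ℓ
  OneFree L u = ∀ {v w} → u ~ v → u ~ w → v ∉ L → w ∉ L → v ≡ w

  -- The layout grows greedily, newest vertex first.  Only its two newest vertices
  -- may have neighbours yet to be placed, and those of the older one come first.
  data Frontier : List (Fin n) → Set where
    settled : ∀ {L} → All (Closed L) (drop 1 L) → Frontier L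
    pending : ∀ {q p L} → All (Closed (q ∷ p ∷ L)) L → OneFree (q ∷ p ∷ L) p → OneFree (q ∷ p ∷ L) q →
              Frontier (q ∷ p ∷ L)

  -- Positions are counted in the tail `L`; below 2 there means at most 2 away from `r` in `r ∷ L`.
  data Band : List (Fin n) → Set where
    []  : Band []
    _∷_ : ∀ {r L} → (∀ {v} (v∈L : v ∈ L) → r ~ v → toℕ (index v∈L) < 2) → Band L → Band (r ∷ L)

  closed-∷ : ∀ {r L u} → Closed L u → Closed (r ∷ L) u
  closed-∷ closed = there ∘ closed

  oneFree-∷ : ∀ {r L u} → OneFree L u → OneFree (r ∷ L) u
  oneFree-∷ one u~v u~w v∉ w∉ = one u~v u~w (v∉ ∘ there) (w∉ ∘ there)

  -- The placed vertex `r` takes up one of the at most two neighbours of `u`.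
  oneFree : ∀ {L u r} → u ~ r → r ∈ L → OneFree L u
  oneFree u~r r∈L u~v u~w v∉L w∉L with neighbours-coincide u~r u~v u~w
  ... | inj₁ refl        = contradiction r∈L v∉L
  ... | inj₂ (inj₁ refl) = contradiction r∈L w∉L
  ... | inj₂ (inj₂ v≡w)  = v≡w

  oneFree⇒closed : ∀ {L u r} → OneFree L u → u ~ r → r ∉ L → Closed (r ∷ L) u
  oneFree⇒closed {L} one u~r r∉L {v} u~v with v ∈? L
  ... | yes v∈L = there v∈L
  ... | no  v∉L = here (one u~v u~r v∉L r∉L)

  freeNeighbour : ∀ L u → (∃[ r ] u ~ r × r ∉ L) ⊎ Closed L u
  freeNeighbour L u with Fin.any? (λ r → (u ~? r) ×-dec ¬? (r ∈? L))
  ... | yes found = inj₁ found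
  ... | no ¬found = inj₂ λ {v} u~v → decidable-stable (v ∈? L) λ v∉L → ¬found (v , u~v , v∉L)

  fresh : ∀ L → length L < n → ∃[ r ] r ∉ L
  fresh L |L|<n with Fin.any? (λ r → ¬? (r ∈? L))
  ... | yes found = found
  ... | no ¬found = contradiction (Fin.injective⇒≤ (index-injective (setoid (Fin n)) (mem _) (mem _))) (ℕ.<⇒≱ |L|<n)
    where
    mem : ∀ v → v ∈ L
    mem v = decidable-stable (v ∈? L) λ v∉L → ¬found (v , v∉L)

  -- If the newest vertex has a free neighbour, place it: the edge between them uses up one
  -- neighbour of each. Otherwise all of `L` is closed, and any fresh vertex can start a new
  -- component.
  extendSettled : ∀ L → All (Closed L) (drop 1 L) → length L < n →
    ∃[ r ] r ∉ L × Frontier (r ∷ L)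
  extendSettled [] _ |L|<n = let r , r∉L = fresh [] |L|<n in r , r∉L , settled []
  extendSettled L@(q ∷ L′) closed |L|<n with freeNeighbour L q
  ... | inj₁ (r , q~r , r∉L) = r , r∉L ,
    pending (All.map closed-∷ closed) (oneFree q~r (here refl)) (oneFree (~-sym q~r) (there (here refl)))
  ... | inj₂ q-closed = let r , r∉L = fresh L |L|<n in r , r∉L ,
    settled (All.map closed-∷ (q-closed ∷ closed))

  -- Placing the free neighbour `r` of `p` closes `p`, which is then two positions from `r`, and
  -- makes `q` the older of the two open vertices. If `p` has no free neighbour, only `q` can be
  -- open, as in the settled case.
  extend : ∀ {L} → Frontier L → length L < n → ∃[ r ] r ∉ L × Frontier (r ∷ L)
  extend (settled closed) |L|<n = extendSettled _ closed |L|<n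
  extend {L} (pending {q} {p} closed p-one q-one) |L|<n with freeNeighbour L p
  ... | inj₁ (r , p~r , r∉L) = r , r∉L ,
    pending (oneFree⇒closed p-one p~r r∉L ∷ All.map closed-∷ closed) (oneFree-∷ q-one)
            (oneFree (~-sym p~r) (there (there (here refl))))
  ... | inj₂ p-closed = extendSettled L (p-closed ∷ closed) |L|<n

  frontier-drop2 : ∀ {L} → Frontier L → All (Closed L) (drop 2 L)
  frontier-drop2 (pending closed _ _) = closed
  frontier-drop2 (settled {[]} _) = []
  frontier-drop2 (settled {_ ∷ []} _) = []
  frontier-drop2 (settled {_ ∷ _ ∷ _} (_ ∷ closed)) = closed

  layout : ∀ k → k ≤ n → ∃[ L ] length L ≡ k × Unique L × Band L × Frontier L
  layout zero _ = [] , refl , [] , [] , settled []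
  layout (suc k) k<n
    with L , refl , unique , band , frontier ← layout k (ℕ.<⇒≤ k<n)
    with r , r∉L , frontier′ ← extend frontier k<n =
    r ∷ L , refl , ¬Any⇒All¬ _ r∉L ∷ unique ,
    -- A neighbour of `r` older than the two newest vertices would be closed, so `r` would already
    -- be in `L`.
    (λ v∈L r~v → index<2 (frontier-drop2 frontier) v∈L λ closed → r∉L (closed (~-sym r~v))) ∷ band ,
    frontier′

  -- One inequality suffices, as symmetry of `_~_` gives the other.
  band⇒index≤ : ∀ {L} → Band L → ∀ {u v} (u∈L : u ∈ L) (v∈L : v ∈ L) → u ~ v →
    toℕ (index u∈L) ≤ 2 + toℕ (index v∈L)
  band⇒index≤ _          (here _)    _           _   = z≤n
  band⇒index≤ (near ∷ _) (there u∈L) (here refl) u~v = near u∈L (~-sym u~v)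
  band⇒index≤ (_ ∷ band) (there u∈L) (there v∈L) u~v = s≤s (band⇒index≤ band u∈L v∈L u~v)

  bandwidth≤2 : ∃₂ λ m (σ : Fin n → Fin m) → m ≤ n × (∀ {u v} → σ u ≡ σ v → u ≡ v) ×
    (∀ {u v} → u ~ v → toℕ (σ u) ≤ 2 + toℕ (σ v))
  bandwidth≤2 with L , |L|≡n , unique , band , _ ← layout n ℕ.≤-refl =
    length L , (λ v → index (mem v)) , ℕ.≤-reflexive |L|≡n ,
    index-injective (setoid (Fin n)) (mem _) (mem _) , λ u~v → band⇒index≤ band (mem _) (mem _) u~v
    where
    mem : ∀ v → v ∈ L
    -- A missing `v` would make `v ∷ L` a list of n + 1 distinct vertices.
    mem v = decidable-stable (v ∈? L) λ v∉L →
      contradiction (Fin.injective⇒≤ (unique⇒lookup-injective (¬Any⇒All¬ _ v∉L ∷ unique)))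
        (ℕ.<⇒≱ (s≤s (ℕ.≤-reflexive (sym |L|≡n))))

-- Existence of the minimum, by deciding the arrow relation

-- Constructively the search for a minimum rests on decidability of `P`; the decision procedures
-- below serve this.
least : ∀ {ℓ} {P : Pred ℕ ℓ} → Decidable P → ∀ {N} → P N → ∃[ m ] IsMinimumOf P m
least {P = P} P? {N} pN = [ id , (λ ¬P → N , pN , λ k pk → ℕ.≮⇒≥ λ k<N → ¬P k<N pk) ]′ (below N)
  where
  below : ∀ N → ∃ (IsMinimumOf P) ⊎ (∀ {k} → k < N → ¬ P k)
  below zero = inj₂ λ ()
  below (suc N) with below N | P? N
  ... | inj₁ found | _      = inj₁ found
  ... | inj₂ ¬P    | yes pN = inj₁ (N , pN , λ k pk → ℕ.≮⇒≥ λ k<N → ¬P k<N pk)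
  ... | inj₂ ¬P    | no ¬pN = inj₂ λ k<1+N → [ ¬P , (λ { refl → ¬pN }) ]′ (ℕ.m≤n⇒m<n∨m≡n (ℕ.≤-pred k<1+N))

-- The search over codes reaches a function only up to `≗`, so `P` must respect it.
anyFunction? : ∀ {m n ℓ} {P : Pred (Fin m → Fin n) ℓ} → P Respects _≗_ → Decidable P → Dec (∃ P)
anyFunction? resp P? = map′ (λ (κ , p) → finToFun κ , p)
  (λ (f , p) → funToFin f , resp (sym ∘ Fin.finToFun-funToFin f) p)
  (Fin.any? (P? ∘ finToFun))

anyBool? : ∀ {ℓ} {P : Pred Bool ℓ} → Decidable P → Dec (∃ P)
anyBool? P? = map′ [ (true ,_) , (false ,_) ]′ (λ { (true , p) → inj₁ p ; (false , p) → inj₂ p })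
  (P? true ⊎-dec P? false)

open Colouring using (colour)

-- The conjunction makes every bit matrix, symmetric or not, a colouring.
decode : ∀ {N} → Fin ((2 ^ N) ^ N) → Colouring N
decode {N} κ = record { colour = λ u v → bit u v ∧ bit v u ; comm = λ u v → Bool.∧-comm (bit u v) (bit v u) }
  where
  bit : Fin N → Fin N → Bool
  bit u v = Inverse.to Fin.2↔Bool (finToFun (finToFun {2 ^ N} κ u) v)

encode : ∀ {N} → Colouring N → Fin ((2 ^ N) ^ N)
encode χ = funToFin λ u → funToFin λ v → Inverse.from Fin.2↔Bool (colour χ u v)

decode-encode : ∀ {N} (χ : Colouring N) u v → colour (decode (encode χ)) u v ≡ colour χ u v
decode-encode {N} χ u v =
  trans (cong₂ _∧_ (bit u v) (trans (bit v u) (Colouring.comm χ v u))) (Bool.∧-idem (colour χ u v))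
  where
  bit : ∀ u v → Inverse.to Fin.2↔Bool (finToFun (finToFun {2 ^ N} (encode χ) u) v) ≡ colour χ u v
  bit u v
    rewrite Fin.finToFun-funToFin (λ u → funToFin λ v → Inverse.from Fin.2↔Bool (colour χ u v)) u
          | Fin.finToFun-funToFin (λ v → Inverse.from Fin.2↔Bool (colour χ u v)) v =
    Inverse.strictlyInverseˡ Fin.2↔Bool (colour χ u v)

orderBy : ∀ {n K} (ρ : Fin n → Fin K) → Injective _≡_ _≡_ ρ → VertexOrder n
orderBy ρ ρ-injective = record
  { _≺_ = λ u v → ρ u Fin.< ρ v
  ; isStrictTotalOrder = OrderMonomorphism.isStrictTotalOrder ρ-mono Fin.<-isStrictTotalOrder }
  where
  ρ-mono : IsOrderMonomorphism _≡_ _≡_ (λ u v → ρ u Fin.< ρ v) Fin._<_ ρ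
  ρ-mono = record { isOrderHomomorphism = record { cong = cong ρ ; mono = id } ; injective = ρ-injective ; cancel = id }

module _ {n} (G : Graph n) where
  open Graph G using (_~_; _~?_; irrefl)

  -- A searchable form of a monochromatic copy: when `_≺_` is a strict total order, injectivity and
  -- reflection of the order follow from monotonicity, as `copy` shows.
  HasCopy : ∀ {N} → Rel (Fin n) 0ℓ → (Fin N → Fin N → Bool) → Set
  HasCopy {N} _≺_ χ = ∃₂ λ (e : Fin n → Fin N) c →
    ∀ u v → (u ≺ v → e u Fin.< e v) × (u ~ v → χ (e u) (e v) ≡ c)

  hasCopy-resp : ∀ {N} {_≺_ _≺′_ : Rel (Fin n) 0ℓ} (χ χ′ : Fin N → Fin N → Bool) →
    (∀ {u v} → u ≺′ v → u ≺ v) → (∀ u v → χ u v ≡ χ′ u v) → HasCopy _≺_ χ → HasCopy _≺′_ χ′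
  hasCopy-resp _ _ ≺′⇒≺ χ≗χ′ (e , c , h) = e , c , λ u v →
    proj₁ (h u v) ∘ ≺′⇒≺ , λ u~v → trans (sym (χ≗χ′ _ _)) (proj₂ (h u v) u~v)

  hasCopy? : ∀ {N} {_≺_ : Rel (Fin n) 0ℓ} → Decidable₂ _≺_ → (χ : Fin N → Fin N → Bool) → Dec (HasCopy _≺_ χ)
  hasCopy? {N} {_≺_} _≺?_ χ = anyFunction? {P = IsCopy} respects λ e → anyBool? λ c → Fin.all? λ u → Fin.all? λ v →
    ((u ≺? v) →-dec (e u Fin.<? e v)) ×-dec ((u ~? v) →-dec (χ (e u) (e v) Bool.≟ c))
    where
    IsCopy : Pred (Fin n → Fin N) 0ℓ
    IsCopy e = ∃[ c ] ∀ u v → (u ≺ v → e u Fin.< e v) × (u ~ v → χ (e u) (e v) ≡ c)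

    respects : IsCopy Respects _≗_
    respects e≗e′ (c , h) = c , λ u v →
      (λ u≺v → subst₂ Fin._<_ (e≗e′ u) (e≗e′ v) (proj₁ (h u v) u≺v)) ,
      (λ u~v → trans (sym (cong₂ χ (e≗e′ u) (e≗e′ v))) (proj₂ (h u v) u~v))

  module _ (ord : VertexOrder n) where
    open VertexOrder ord
    open IsStrictTotalOrder isStrictTotalOrder using (compare)

    copy : ∀ {N} (χ : Colouring N) → HasCopy _≺_ (colour χ) → ∃[ H ] Monochromatic {𝒢 = G , ord} χ H
    copy χ (e , c , h) = record
      { embed = e
      ; isOrderMonomorphism = record
        { isOrderHomomorphism = record { cong = cong e ; mono = mono } ; injective = injective ; cancel = cancel }
      ; preserves-~ = λ u~v eu≡ev → irrefl (injective eu≡ev) u~v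
      } , c , λ u~v → proj₂ (h _ _) u~v
      where
      mono : ∀ {u v} → u ≺ v → e u Fin.< e v
      mono = proj₁ (h _ _)
      injective : ∀ {u v} → e u ≡ e v → u ≡ v
      injective {u} {v} eq with compare u v
      ... | tri< u≺v _ _ = contradiction eq (Fin.<⇒≢ (mono u≺v))
      ... | tri≈ _ u≡v _ = u≡v
      ... | tri> _ _ v≺u = contradiction (sym eq) (Fin.<⇒≢ (mono v≺u))
      cancel : ∀ {u v} → e u Fin.< e v → u ≺ v
      cancel {u} {v} lt with compare u v
      ... | tri< u≺v _ _ = u≺v
      ... | tri≈ _ u≡v _ = contradiction (cong e u≡v) (Fin.<⇒≢ lt)
      ... | tri> _ _ v≺u = contradiction lt (Fin.<-asym (mono v≺u))

    hasCopy : ∀ {N} (χ : Colouring N) → ∃[ H ] Monochromatic {𝒢 = G , ord} χ H → HasCopy _≺_ (colour χ)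
    hasCopy χ (H , c , h) = Copy.embed H , c , λ u v → IsOrderMonomorphism.mono (Copy.isOrderMonomorphism H) , h

  -- A copy of (G , ≺) in any one colouring of 𝒦 N presents ≺ by a ranking into
  -- Fin N, so only finitely many orders need to be searched.
  arrows? : ∀ N → Dec (∃[ ≺ ] N ⟶ (G , ≺))
  arrows? N = map′ fromRanks toRanks (anyFunction? respects ranksArrowing?)
    where
    constant : Colouring N
    constant = record { colour = λ _ _ → true ; comm = λ _ _ → refl }

    RanksArrowing : Pred (Fin n → Fin N) 0ℓ
    RanksArrowing ρ = (∀ u v → ρ u ≡ ρ v → u ≡ v) ×
      ((χ : Colouring N) → HasCopy (λ u v → ρ u Fin.< ρ v) (colour χ))

    respects : RanksArrowing Respects _≗_
    respects ρ≗ρ′ (ρ-injective , h) =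
      (λ u v eq → ρ-injective u v (trans (ρ≗ρ′ u) (trans eq (sym (ρ≗ρ′ v))))) ,
      (λ χ → hasCopy-resp (colour χ) (colour χ) (λ {u} {v} → subst₂ Fin._<_ (sym (ρ≗ρ′ u)) (sym (ρ≗ρ′ v))) (λ _ _ → refl) (h χ))

    ranksArrowing? : Decidable RanksArrowing
    ranksArrowing? ρ =
      (Fin.all? λ u → Fin.all? λ v → (ρ u Fin.≟ ρ v) →-dec (u Fin.≟ v)) ×-dec
      map′ (λ h χ → hasCopy-resp _ (colour χ) id (decode-encode χ) (h (encode χ))) (λ h κ → h (decode κ))
           (Fin.all? λ κ → hasCopy? (λ u v → ρ u Fin.<? ρ v) (colour (decode {N} κ)))

    fromRanks : ∃ RanksArrowing → ∃[ ≺ ] N ⟶ (G , ≺)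
    fromRanks (ρ , ρ-injective , h) = ord , λ χ → copy ord χ (h χ)
      where ord = orderBy ρ (ρ-injective _ _)

    toRanks : ∃[ ≺ ] N ⟶ (G , ≺) → ∃ RanksArrowing
    toRanks (ord , arrow) = embed , (λ _ _ → injective) , λ χ →
      -- The ranks reflect `≺` by `cancel`, so a copy for `≺` is one for the order by rank.
      hasCopy-resp (colour χ) (colour χ) cancel (λ _ _ → refl) (hasCopy ord χ (arrow χ))
      where
      open Copy (proj₁ (arrow constant))
      open IsOrderMonomorphism isOrderMonomorphism

  -- The least `r` that arrows some ordering is the ordered Ramsey number of that ordering, and no
  -- other ordering has a smaller one.
  minOrderedRamseyNumber≤ : ∀ {N} → ∃[ ≺ ] N ⟶ (G , ≺) → ∃[ r ] MinOrderedRamseyNumber G r × r ≤ N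
  minOrderedRamseyNumber≤ arrow with r , (ord , r-arrows) , r-least ← least arrows? arrow =
    r , ((ord , r-arrows , λ k k-arrows → r-least k (ord , k-arrows)) ,
         λ k (≺′ , k-arrows , _) → r-least k (≺′ , k-arrows)) ,
    r-least _ arrow

  -- The linear bound for maximum degree at most 2

  -- `suc (432 * n)` is the least interval length that `monoPathSquare` admits. Ordering by `mod3`
  -- of the position, then by the position, matches the order on the path square.
  maxDegree≤2⇒arrows : maxDegree G ≤ 2 → ∃[ ≺ ] 6 * suc (432 * n) ⟶ (G , ≺)
  maxDegree≤2⇒arrows Δ≤2 with m , σ , m≤n , σ-injective , near ← Bandwidth.bandwidth≤2 G Δ≤2 =
    ord , λ χ → copy ord χ (found χ (monoPathSquare χ ℕ.≤-refl))
    where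
    ρ : Fin n → Fin (3 * m)
    ρ v = combine (mod3 (toℕ (σ v))) (σ v)

    ord : VertexOrder n
    ord = orderBy ρ λ {u} {v} eq → σ-injective (Fin.combine-injectiveʳ (mod3 (toℕ (σ u))) _ (mod3 (toℕ (σ v))) _ eq)

    found : ∀ {N} (χ : Colouring N) → MonoPathSquare (colour χ) n →
      HasCopy (VertexOrder._≺_ ord) (colour χ)
    found χ square = (λ v → vertex (toℕ (σ v))) , c , λ u v → mono u v , adjacent u v
      where
      open MonoPathSquare square

      mono : ∀ u v → ρ u Fin.< ρ v → vertex (toℕ (σ u)) Fin.< vertex (toℕ (σ v))
      mono u v lt with Fin.<-cmp (mod3 (toℕ (σ u))) (mod3 (toℕ (σ v)))
      ... | tri< mod< _ _ = mono₁ mod<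
      ... | tri> _ _ mod> = contradiction lt (Fin.<-asym (Fin.combine-monoˡ-< (σ v) (σ u) mod>))
      ... | tri≈ _ mod≡ _ with Fin.<-cmp (σ u) (σ v)
      ...   | tri< σ< _ _ = mono₂ σ< (ℕ.<-≤-trans (Fin.toℕ<n (σ v)) m≤n) mod≡
      ...   | tri≈ _ σ≡ _ = contradiction lt (Fin.<-irrefl (cong₂ combine mod≡ σ≡))
      ...   | tri> _ _ σ> = contradiction lt (Fin.<-asym (combine-monoʳ-< (sym mod≡) σ>))

      adjacent : ∀ u v → u ~ v → colour χ (vertex (toℕ (σ u))) (vertex (toℕ (σ v))) ≡ c
      adjacent u v u~v with Fin.<-cmp (σ u) (σ v)
      ... | tri< σ< _ _ = edge σ< (near (Graph.sym G u~v))
      ... | tri≈ _ σ≡ _ = contradiction u~v (irrefl (σ-injective σ≡))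
      ... | tri> _ _ σ> = trans (Colouring.comm χ _ _) (edge σ> (near u~v))

theorem3p2 : ∃[ C ] ((n : ℕ) → 0 < n → (G : Graph n) → maxDegree G ≤ 2 →
    ∃[ r ] (MinOrderedRamseyNumber G r × r ≤ C * n))
theorem3p2 = 6 * 433 , λ n 0<n G Δ≤2 →
  let r , isMin , r≤ = minOrderedRamseyNumber≤ G (maxDegree≤2⇒arrows G Δ≤2) in
  r , isMin , ℕ.≤-trans r≤ (begin
    -- Since 1 ≤ `n`, the extra vertex of each interval is absorbed into 433 `n`.
    6 * suc (432 * n)   ≤⟨ ℕ.*-monoʳ-≤ 6 (ℕ.+-monoˡ-≤ (432 * n) 0<n) ⟩
    6 * (433 * n)       ≡⟨ ℕ.*-assoc 6 433 n ⟨
    6 * 433 * n         ∎)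
  where open ℕ.≤-Reasoning
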